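{- The shortcut rule is correct: whenever $\mathcal N_2$ is obtained from a negotiation $\mathcal N_1$ by one application of the shortcut rule, $\mathcal N_2$ is a negotiation equivalent to $\mathcal N_1$.
   Context: Fix a finite set $\mathcal A$ of agents; each $p\in\mathcal A$ has a nonempty set $Q_p$ of internal states, and $Q_{\mathcal A}=\prod_{p\in\mathcal A}Q_p$. A transformer is a left-total relation $\tau\subseteq Q_{\mathcal A}\times Q_{\mathcal A}$. For $P\subseteq\mathcal A$, a $P$-transformer is a transformer $\tau$ such that $(q,q')\in\tau$ implies $q_p=q'_p$ for every $p\notin P$. Concatenation $\tau_1\tau_2$ of transformers is relational composition (first $\tau_1$, then $\tau_2$). An atom is a triple $n=(P_n,R_n,\delta_n)$ with $\emptyset\ne P_n\subseteq\mathcal A$ (parties), $R_n$ a finite nonempty set of results, and $\delta_n$ assigning to each $r\in R_n$ a $P_n$-transformer $\delta_n(r)$. Pairs $(n,r)$ with $r\in R_n$ are outcomes. For a finite set $N$ of atoms let $T(N)=\{(n,p,r): n\in N,\ p\in P_n,\ r\in R_n\}$. A negotiation is a tuple $\mathcal N=(N,n_0,n_f,\mathcal X)$ with $n_0,n_f\in N$ (initial and final atom) and $\mathcal X:T(N)\to 2^N$, such that: (1) $P_{n_0}=P_{n_f}=\mathcal A$; (2) $\mathcal X(n,p,r)=\emptyset$ iff $n=n_f$; (3) every atom lies on some path from $n_0$ to $n_f$, where a path is a sequence $(n_1,p_1,r_1)\cdots(n_k,p_k,r_k)$ in $T(N)$ with $n_{i+1}\in\mathcal X(n_i,p_i,r_i)$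 for $1\le i\le k-1$. Convention: every atom in $\mathcal X(n,p,r)$ has $p$ as a party. A marking is a map $x:\mathcal A\to 2^N$; initial marking $x_0(p)=\{n_0\}$, final marking $x_f(p)=\emptyset$ for all $p$. A marking $x$ enables $n$ if $n\in x(p)$ for all $p\in P_n$; then for every $r\in R_n$ the outcome $(n,r)$ can occur, leading to $x'$ with $x'(p)=\mathcal X(n,p,r)$ for $p\in P_n$ and $x'(p)=x(p)$ otherwise. Occurrence sequences are finite sequences of outcomes occurring successively from a marking; a marking is reachable if an occurrence sequence leads to it from $x_0$. A large step is an occurrence sequence from $x_0$ to $x_f$. $\mathcal N$ is sound if (a) every atom is enabled at some reachable marking, and (b) every occurrence sequence from $x_0$ is a large step or can be extended to one. Final results are the results of $n_f$. For a final result $r$, the summary transformer $\langle\mathcal N,r\rangle$ is the union, over all large steps $(n_1,r_1)\cdots(n_k,r_k)$ ending with $(n_f,r)$, of $\delta_{n_1}(r_1)\cdots\delta_{n_k}(r_k)$. Two negotiations over the same agents are equivalent if they are both sound or both unsound, have the same final results, and have the same summary transformer for every final result. An outcome $(n,r)$ unconditionally enables an atom $n'$ if $P_n\supseteq P_{n'}$ and $\mathcal X(n,p,r)=\{n'\}$ for every $p\in P_{n'}$. $(n,r)$ has exclusive access to $n'$ if for each $p\in P_{n'}$: $n'\in\mathcal X(n,p,r)$, and $n'\notin\mathcal X(n'',p,r'')$ for all $(n'',r'')\ne(n,r)$. $(n'',r'')$ commits to $n'$ if $\mathcal X(n'',p,r'')=\{n'\}$ for some $p\in P_{n''}$. Shortcut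 rule. Guard: some outcome $(n,r)$ unconditionally enables an atom $n'\neq n$, and moreover one of the following holds: $n'\ne n_f$ and $(n,r)$ has exclusive access to $n'$; or $n'\neq n_f$ and some outcome $(n'',r'')\ne(n,r)$ commits to $n'$; or $n'=n_f$, $(n,r)$ has exclusive access to $n'$, and $r$ is the only result of $n$. Action: (1) replace $r$ in $R_n$ by new results $r'_s$, one for each $r'\in R_{n'}$, where the $r'_s$ are fresh names; (2) for all $r'\in R_{n'}$ set $\mathcal X(n,p,r'_s)=\mathcal X(n',p,r')$ for $p\in P_{n'}$ and $\mathcal X(n,p,r'_s)=\mathcal X(n,p,r)$ for $p\in P_n\setminus P_{n'}$; (3) for all $r'\in R_{n'}$ set $\delta_n(r'_s)=\delta_n(r)\,\delta_{n'}(r')$; (4) if $(n,r)$ has exclusive access to $n'$, remove $n'$; (5) if $n'$ was the final atom before applying the rule and is removed, $n$ is the new final atom.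
   Formalization: P-transformers may also not depend on agents outside P (otherwise summaries can differ); the rule must not remove the initial atom; if the final atom is removed, its results r' are identified with the fresh names r'_s. -}

module Defs where

open import Data.Bool using (if_then_else_)
open import Data.Fin using (Fin; _≟_)
open import Data.Fin.Subset using (Subset; _∈_; _∉_; _⊆_; Nonempty; ⊤; ⊥; ⁅_⁆; _-_)
open import Data.Fin.Subset.Properties using (_∈?_)
open import Data.List using (List; []; _∷_; _++_; _∷ʳ_; map; filter; head; last)
open import Data.List.Membership.Propositional using () renaming (_∈_ to _∈ˡ_; _∉_ to _∉ˡ_)
open import Data.List.Relation.Binary.BagAndSetEquality using (_∼[_]_; set)
open import Data.List.Relation.Unary.All using (All)
open import Data.List.Relation.Unary.Linked using (Linked)
open import Data.Maybe using (just)
import Data.Nat as ℕ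
open import Data.Nat using (ℕ)
open import Data.Product using (_×_; _,_; ∃; ∃₂; proj₁)
open import Data.Sum using (_⊎_)
open import Function using (id) renaming (_⇔_ to _↔ᵖ_)
open import Level using (Level; suc)
open import Relation.Binary using (Rel) renaming (_⇔_ to _≐_)
open import Relation.Binary.Construct.Composition using (_;_)
open import Relation.Binary.PropositionalEquality using (_≡_; _≢_)
open import Relation.Nullary using (¬_; ¬?; does; yes; no)

module _ {ℓ : Level} {a : ℕ} (Q : Fin a → Set ℓ) where

  State : Set ℓ
  State = (p : Fin a) → Q p

  Relation : Set (suc ℓ)
  Relation = Rel State ℓ

  record IsTransformerOn (P : Subset a) (τ : Relation) : Set ℓ where
    field
      left-total : ∀ q → ∃ λ q′ → τ q q′
      unchanged  : ∀ {q q′} → τ q q′ → ∀ {p} → p ∉ P → q p ≡ q′ p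
      -- Agents outside P are not read either: τ is a relation on the P-components
      -- extended by the identity.  With `unchanged` alone, transformers of atoms
      -- with disjoint parties need not commute, and then shortcutting an outcome
      -- n followed by n′ loses the interleavings that have another atom in between.
      local : ∀ {q q′ u u′} → τ q q′ →
              (∀ {p} → p ∈ P → q p ≡ u p) →
              (∀ {p} → p ∈ P → q′ p ≡ u′ p) →
              (∀ {p} → p ∉ P → u p ≡ u′ p) →
              τ u u′

  -- Atoms are named by elements of Fin k and results by natural numbers.
  -- The values of `parties`, `results`, `δ` and `X` matter only on atoms of the
  -- net, their parties and their results; nothing is required elsewhere.
  record Net (k : ℕ) : Set (suc ℓ) where
    field
      atoms   : Subset k
      n₀ nf   : Fin k
      parties : Fin k → Subset a
      results : Fin k → List ℕ
      δ       : Fin k → ℕ → Relation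
      X       : Fin k → Fin a → ℕ → Subset k

module _ {ℓ : Level} {a k : ℕ} {Q : Fin a → Set ℓ} (N : Net Q k) where
  open Net N

  Outcome : Set
  Outcome = Fin k × ℕ

  IsOutcome : Outcome → Set
  IsOutcome (n , r) = n ∈ atoms × r ∈ˡ results n

  Triple : Set
  Triple = Fin k × Fin a × ℕ

  T : Triple → Set
  T (n , p , r) = n ∈ atoms × p ∈ parties n × r ∈ˡ results n

  Step : Triple → Triple → Set
  Step (n , p , r) (m , _ , _) = m ∈ X n p r

  IsPath : Fin k → Fin k → List Triple → Set
  IsPath n m π = All T π × Linked Step π ×
                 head (map proj₁ π) ≡ just n × last (map proj₁ π) ≡ just m

  record IsNegotiation : Set ℓ where
    field
      n₀∈atoms         : n₀ ∈ atoms
      nf∈atoms         : nf ∈ atoms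
      parties-nonempty : ∀ {n} → n ∈ atoms → Nonempty (parties n)
      results-nonempty : ∀ {n} → n ∈ atoms → ∃ λ r → r ∈ˡ results n
      δ-transformer    : ∀ {n r} → IsOutcome (n , r) → IsTransformerOn Q (parties n) (δ n r)
      X⊆atoms          : ∀ {n p r} → T (n , p , r) → X n p r ⊆ atoms
      X-party          : ∀ {n p r m} → T (n , p , r) → m ∈ X n p r → p ∈ parties m
      parties-n₀       : parties n₀ ≡ ⊤
      parties-nf       : parties nf ≡ ⊤
      X-empty          : ∀ {n p r} → T (n , p , r) → X n p r ≡ ⊥ ↔ᵖ n ≡ nf
      on-path          : ∀ {n} → n ∈ atoms → ∃ λ π → IsPath n₀ nf π × n ∈ˡ map proj₁ π

  Marking : Set
  Marking = Fin a → Subset k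

  initial : Marking
  initial _ = ⁅ n₀ ⁆

  IsFinal : Marking → Set
  IsFinal x = ∀ p → x p ≡ ⊥

  Enables : Marking → Fin k → Set
  Enables x n = n ∈ atoms × (∀ {p} → p ∈ parties n → n ∈ x p)

  fire : Marking → Outcome → Marking
  fire x (n , r) p = if does (p ∈? parties n) then X n p r else x p

  infixr 5 _∷_

  data Occurs (x : Marking) : List Outcome → Marking → Set where
    []  : Occurs x [] x
    _∷_ : ∀ {n r σ y} → Enables x n × r ∈ˡ results n →
          Occurs (fire x (n , r)) σ y → Occurs x ((n , r) ∷ σ) y

  Reachable : Marking → Set
  Reachable x = ∃ λ σ → Occurs initial σ x

  LargeStep : List Outcome → Set
  LargeStep σ = ∃ λ y → Occurs initial σ y × IsFinal y

  record Sound : Set where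
    field
      enabled     : ∀ {n} → n ∈ atoms → ∃ λ x → Reachable x × Enables x n
      completable : ∀ {σ x} → Occurs initial σ x → ∃ λ τ → LargeStep (σ ++ τ)

  finalResults : List ℕ
  finalResults = results nf

  ⟦_⟧ : List Outcome → Relation Q
  ⟦ [] ⟧          = _≡_
  ⟦ (n , r) ∷ σ ⟧ = δ n r ; ⟦ σ ⟧

  Summary : ℕ → Relation Q
  Summary r q q′ = ∃ λ σ → LargeStep (σ ∷ʳ (nf , r)) × ⟦ σ ∷ʳ (nf , r) ⟧ q q′

  UnconditionallyEnables : Outcome → Fin k → Set
  UnconditionallyEnables (n , r) n′ =
    parties n′ ⊆ parties n × (∀ {p} → p ∈ parties n′ → X n p r ≡ ⁅ n′ ⁆)

  ExclusiveAccess : Outcome → Fin k → Set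
  ExclusiveAccess (n , r) n′ = ∀ {p} → p ∈ parties n′ →
    n′ ∈ X n p r ×
    (∀ {m t} → T (m , p , t) → (m , t) ≢ (n , r) → n′ ∉ X m p t)

  CommitsTo : Outcome → Fin k → Set
  CommitsTo (m , t) n′ = ∃ λ p → p ∈ parties m × X m p t ≡ ⁅ n′ ⁆

  ShortcutGuard : Outcome → Fin k → Set
  ShortcutGuard (n , r) n′ =
      (n′ ≢ nf × ExclusiveAccess (n , r) n′)
    ⊎ (n′ ≢ nf × ∃ λ o → IsOutcome o × o ≢ (n , r) × CommitsTo o n′)
    ⊎ (n′ ≡ nf × ExclusiveAccess (n , r) n′ × (∀ {t} → t ∈ˡ results n → t ≡ r))

module _ {ℓ : Level} {a k : ℕ} {Q : Fin a → Set ℓ} where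

  record Shortcut (N₁ N₂ : Net Q k) : Set ℓ where
    private
      module N₁ = Net N₁
      module N₂ = Net N₂
    field
      n n′ : Fin k
      r    : ℕ
      s    : ℕ → ℕ

      outcome : IsOutcome N₁ (n , r)
      n′∈     : n′ ∈ N₁.atoms
      n′≢n    : n′ ≢ n
      enables : UnconditionallyEnables N₁ (n , r) n′
      guard   : ShortcutGuard N₁ (n , r) n′
      -- An outcome may have exclusive access to the initial atom (which is marked
      -- at the start without any outcome); removing it would leave no initial atom.
      n₀-kept : ExclusiveAccess N₁ (n , r) n′ → n′ ≢ N₁.n₀

      s-injective : ∀ {t u} → t ∈ˡ N₁.results n′ → u ∈ˡ N₁.results n′ → s t ≡ s u → t ≡ u
      s-fresh     : ∀ {t} → t ∈ˡ N₁.results n′ → s t ∉ˡ N₁.results n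

      atoms-removed : ExclusiveAccess N₁ (n , r) n′ → N₂.atoms ≡ N₁.atoms - n′
      atoms-kept    : ¬ ExclusiveAccess N₁ (n , r) n′ → N₂.atoms ≡ N₁.atoms
      n₀-same       : N₂.n₀ ≡ N₁.n₀
      nf-removed    : n′ ≡ N₁.nf × ExclusiveAccess N₁ (n , r) n′ → N₂.nf ≡ n
      nf-kept       : ¬ (n′ ≡ N₁.nf × ExclusiveAccess N₁ (n , r) n′) → N₂.nf ≡ N₁.nf

      parties-same : ∀ {m} → m ∈ N₂.atoms → N₂.parties m ≡ N₁.parties m

      results-n : N₂.results n ∼[ set ]
                  filter (λ t → ¬? (t ℕ.≟ r)) (N₁.results n) ++ map s (N₁.results n′)
      results-≢ : ∀ {m} → m ∈ N₂.atoms → m ≢ n → N₂.results m ∼[ set ] N₁.results m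

      X-new₁ : ∀ {t p} → t ∈ˡ N₁.results n′ → p ∈ N₁.parties n′ →
               N₂.X n p (s t) ≡ N₁.X n′ p t
      X-new₂ : ∀ {t p} → t ∈ˡ N₁.results n′ → p ∈ N₁.parties n → p ∉ N₁.parties n′ →
               N₂.X n p (s t) ≡ N₁.X n p r
      X-old  : ∀ {m t p} → m ∈ N₂.atoms → t ∈ˡ N₁.results m → (m , t) ≢ (n , r) →
               p ∈ N₁.parties m → N₂.X m p t ≡ N₁.X m p t

      δ-new : ∀ {t} → t ∈ˡ N₁.results n′ → N₂.δ n (s t) ≐ (N₁.δ n r ; N₁.δ n′ t)
      δ-old : ∀ {m t} → m ∈ N₂.atoms → t ∈ˡ N₁.results m → (m , t) ≢ (n , r) →
              N₂.δ m t ≐ N₁.δ m t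

    -- The final results change only if the final atom is removed: r′ is renamed r′ₛ.
    finalRenaming : ℕ → ℕ
    finalRenaming with n′ ≟ N₁.nf
    ... | yes _ = s
    ... | no  _ = id

  -- Equivalence with the final results of N₁ identified with those of N₂ along ρ;
  -- for ρ = id this is equivalence with literally the same final results.
  record EquivalentVia (ρ : ℕ → ℕ) (N₁ N₂ : Net Q k) : Set ℓ where
    field
      soundness : Sound N₁ ↔ᵖ Sound N₂
      injective : ∀ {t u} → t ∈ˡ finalResults N₁ → u ∈ˡ finalResults N₁ → ρ t ≡ ρ u → t ≡ u
      results   : finalResults N₂ ∼[ set ] map ρ (finalResults N₁)
      summaries : ∀ {t} → t ∈ˡ finalResults N₁ → Summary N₁ t ≐ Summary N₂ (ρ t)

{-# OPTIONS --safe #-}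

-- Once (n , r) has occurred, every party of n′ is ready for n′ only, so until n′
-- occurs, only atoms with parties disjoint from those of n′ can occur.  These
-- commute with n′, in their effect on the marking and on the agent states.  Hence
-- N₂ can simulate N₁: firing n with result t of n′ at the moment (n , r) occurs,
-- and t being what n′ later yields.  Conversely, an occurrence of (n , s t) in N₂
-- unfolds to (n , r) (n′ , t).  If n′ survives in N₂, the guard supplies another
-- outcome committing to it, after which n′ must become enabled before termination.

module Submission where

open import Data.Fin using (Fin; suc; _≟_)
open import Data.Fin.Subset using (Subset; _∈_; _∉_; _⊆_; ⊤; ⊥; ⁅_⁆; _-_)
open import Data.Fin.Subset.Properties
  using (_∈?_; ∉⊥; ∈⊤; ⊆⊤; ⊆-antisym; x∈⁅x⁆;
         x∈⁅y⁆⇒x≡y; p─q⊆p; x∈p∧x≢y⇒x∈p-y)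
open import Data.List using (List; []; _∷_; _++_; _∷ʳ_; map; filter; head; last)
open import Data.List.Membership.Propositional using () renaming (_∈_ to _∈ˡ_)
open import Data.List.Membership.Propositional.Properties
  using (∈-++⁺ˡ; ∈-++⁺ʳ; ∈-++⁻; ∈-filter⁺; ∈-filter⁻; ∈-map⁺; ∈-map⁻)
open import Data.List.Properties using (map-id)
open import Data.List.Relation.Unary.All using (All; []; _∷_)
open import Data.List.Relation.Unary.Any using (here; there)
open import Data.List.Relation.Unary.Linked using (Linked; [-]; _∷_)
open import Data.Maybe using (just)
import Data.Nat as ℕ
open import Data.Nat using (ℕ)
open import Data.Product using (_×_; _,_; ∃; ∃₂; proj₁; proj₂)
open import Data.Product.Properties using (≡-dec)
open import Data.Sum using (inj₁; inj₂)
open import Data.Vec using (_∷_; there)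
open import Function using (mk⇔; case_of_; _∘_; Equivalence) renaming (_⇔_ to _↔ᵖ_)
open import Level using (Level)
open import Relation.Binary using () renaming (_⇔_ to _≐_)
open import Relation.Binary.Construct.Closure.ReflexiveTransitive using (Star; ε; _◅_; _◅◅_)
open import Relation.Binary.Construct.Composition using (_;_)
open import Relation.Binary.PropositionalEquality
  using (_≡_; _≢_; _≗_; refl; sym; trans; cong; subst; subst₂)
open import Relation.Nullary using (¬_; ¬?; Dec; yes; no; contradiction)
open import Relation.Nullary.Decidable using (decidable-stable)
open import Defs

-- Finite subsets.

⁅x⁆≢⊥ : ∀ {k} {x : Fin k} → ⁅ x ⁆ ≢ ⊥
⁅x⁆≢⊥ {x = x} eq = ∉⊥ (subst (x ∈_) eq (x∈⁅x⁆ x))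

x∉p-x : ∀ {k} (p : Subset k) {x} → x ∉ p - x
x∉p-x (_ ∷ p) {suc x} (there x∈) = x∉p-x p x∈

-- Transformers: composition and commutation.

module _ {ℓ : Level} {a : ℕ} {Q : Fin a → Set ℓ} where

  transformer-resp-≐ : ∀ {P} {τ τ′ : Relation Q} → τ′ ≐ τ →
                       IsTransformerOn Q P τ → IsTransformerOn Q P τ′
  transformer-resp-≐ (to , from) t = record
    { left-total = λ q → let q′ , τqq′ = left-total q in q′ , from τqq′
    ; unchanged  = λ τqq′ → unchanged (to τqq′)
    ; local      = λ τqq′ e e′ f → from (local (to τqq′) e e′ f)
    } where open IsTransformerOn t

  override : Subset a → State Q → State Q → State Q
  override P q u p with p ∈? P
  ... | yes _ = q p
  ... | no  _ = u p

  override-∈ : ∀ {P q u p} → p ∈ P → override P q u p ≡ q p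
  override-∈ {P} {p = p} p∈P with p ∈? P
  ... | yes _   = refl
  ... | no p∉P = contradiction p∈P p∉P

  override-∉ : ∀ {P q u p} → p ∉ P → override P q u p ≡ u p
  override-∉ {P} {p = p} p∉P with p ∈? P
  ... | yes p∈P = contradiction p∈P p∉P
  ... | no _    = refl

  transformer-∘ : ∀ {P P′} {τ τ′ : Relation Q} → P′ ⊆ P →
                  IsTransformerOn Q P τ → IsTransformerOn Q P′ τ′ →
                  IsTransformerOn Q P (τ ; τ′)
  transformer-∘ {P} P′⊆P t t′ = record
    { left-total = λ q → let q₁ , τqq₁   = t.left-total q
                             q₂ , τ′q₁q₂ = t′.left-total q₁
                         in q₂ , q₁ , τqq₁ , τ′q₁q₂
    ; unchanged  = λ (_ , τqq₁ , τ′q₁q₂) p∉P →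
        trans (t.unchanged τqq₁ p∉P) (t′.unchanged τ′q₁q₂ (λ p∈P′ → p∉P (P′⊆P p∈P′)))
    ; local      = λ {q} {q₂} {u} {u₂} (q₁ , τqq₁ , τ′q₁q₂) e e₂ f →
        -- The intermediate state keeps what `τ` produced on `P`; elsewhere it must agree with the
        -- new frame `u`.
        override P q₁ u ,
        t.local τqq₁ e (λ p∈P → sym (override-∈ p∈P)) (λ p∉P → sym (override-∉ p∉P)) ,
        t′.local τ′q₁q₂ (λ p∈P′ → sym (override-∈ (P′⊆P p∈P′))) (λ p∈P′ → e₂ (P′⊆P p∈P′))
          λ {p} p∉P′ → case p ∈? P of λ where
            (yes p∈P) → trans (override-∈ p∈P) (trans (t′.unchanged τ′q₁q₂ p∉P′) (e₂ p∈P))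
            (no p∉P)  → trans (override-∉ p∉P) (f p∉P)
    } where
      module t  = IsTransformerOn t
      module t′ = IsTransformerOn t′

  -- By locality `τ′` reads only the components in `P′`, which `τ` leaves alone, so `τ′` can act
  -- first; `τ` then still finds its own components as they were. The intermediate state is `q` with
  -- only its `P′`-components advanced.
  disjoint-commute : ∀ {P P′} {τ τ′ : Relation Q} → (∀ {p} → p ∈ P → p ∉ P′) →
                     IsTransformerOn Q P τ → IsTransformerOn Q P′ τ′ →
                     ∀ {q q′} → (τ ; τ′) q q′ → (τ′ ; τ) q q′
  disjoint-commute {P} {P′} disjoint t t′ {q} {q₂} (q₁ , τqq₁ , τ′q₁q₂) =
    override P′ q₂ q ,
    t′.local τ′q₁q₂ (λ p∈P′ → sym (t.unchanged τqq₁ (λ p∈P → disjoint p∈P p∈P′)))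
                    (λ p∈P′ → sym (override-∈ p∈P′)) (λ p∉P′ → sym (override-∉ p∉P′)) ,
    t.local τqq₁ (λ p∈P → sym (override-∉ (disjoint p∈P)))
                 (λ p∈P → t′.unchanged τ′q₁q₂ (disjoint p∈P))
      λ {p} p∉P → case p ∈? P′ of λ where
        (yes p∈P′) → override-∈ p∈P′
        (no p∉P′)  → trans (override-∉ p∉P′)
                           (trans (t.unchanged τqq₁ p∉P) (t′.unchanged τ′q₁q₂ p∉P′))
    where
      module t  = IsTransformerOn t
      module t′ = IsTransformerOn t′

module _ {ℓ : Level} {a k : ℕ} {Q : Fin a → Set ℓ} (N : Net Q k) where
  open Net N

  -- Paths and reachability along edges.

  Edge : Fin k → Fin k → Set
  Edge m m′ = ∃₂ λ p t → T N (m , p , t) × m′ ∈ X m p t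

  -- Reachability along edges composes and can be rerouted freely, unlike lists of triples; a path
  -- through `v` is split at `v`.
  path⇒stars : ∀ {e π m v} → All (T N) (e ∷ π) → Linked (Step N) (e ∷ π) →
               last (map proj₁ (e ∷ π)) ≡ just m → v ∈ˡ map proj₁ (e ∷ π) →
               Star Edge (proj₁ e) v × Star Edge v m
  path⇒stars {π = []} _ _ refl (here refl) = ε , ε
  path⇒stars {π = _ ∷ _} (t ∷ ts) (s ∷ ss) eq (here refl) =
    ε , (_ , _ , t , s) ◅ proj₂ (path⇒stars ts ss eq (here refl))
  path⇒stars {π = _ ∷ _} (t ∷ ts) (s ∷ ss) eq (there v∈) =
    let to , from = path⇒stars ts ss eq v∈ in (_ , _ , t , s) ◅ to , from

  edge∷path : ∀ {e n m π} → T N e → n ∈ X (proj₁ e) (proj₁ (proj₂ e)) (proj₂ (proj₂ e)) →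
              IsPath N n m π → IsPath N (proj₁ e) m (e ∷ π)
  edge∷path {π = _ ∷ _} t s (ts , ss , refl , eq) = t ∷ ts , s ∷ ss , refl , eq

  -- The last triple of a path names a party and a result of `m`, although no edge is taken along
  -- it. The argument `T N (m , p , t)` supplies them.
  star⇒path : ∀ {m v p t} → T N (m , p , t) → Star Edge v m →
              ∃ λ π → IsPath N v m π × v ∈ˡ map proj₁ π
  star⇒path t ε = _ , (t ∷ [] , [-] , refl , refl) , here refl
  star⇒path t ((_ , _ , t′ , s) ◅ r) =
    let _ , path , _ = star⇒path t r in _ , edge∷path t′ s path , here refl

  stars⇒path : ∀ {n m v p t} → T N (m , p , t) → Star Edge n v → Star Edge v m →
               ∃ λ π → IsPath N n m π × v ∈ˡ map proj₁ π
  stars⇒path t ε r = star⇒path t r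
  stars⇒path t ((_ , _ , t′ , s) ◅ r) r′ =
    let _ , path , v∈ = stars⇒path t r r′ in _ , edge∷path t′ s path , there v∈

  -- Firing of outcomes.

  fire-∈ : ∀ x {m t p} → p ∈ parties m → fire N x (m , t) p ≡ X m p t
  fire-∈ x {m} {p = p} p∈ with p ∈? parties m
  ... | yes _  = refl
  ... | no p∉ = contradiction p∈ p∉

  fire-∉ : ∀ x {m t p} → p ∉ parties m → fire N x (m , t) p ≡ x p
  fire-∉ x {m} {p = p} p∉ with p ∈? parties m
  ... | yes p∈ = contradiction p∈ p∉
  ... | no _   = refl

  fire-cong : ∀ {x y} o → x ≗ y → fire N x o ≗ fire N y o
  fire-cong (m , _) x≗y p with p ∈? parties m
  ... | yes _ = refl
  ... | no _  = x≗y p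

  fire-comm : ∀ x {m t m′ t′} → (∀ {p} → p ∈ parties m → p ∉ parties m′) →
              fire N (fire N x (m′ , t′)) (m , t) ≗ fire N (fire N x (m , t)) (m′ , t′)
  fire-comm x {m} {t} {m′} {t′} disjoint p with p ∈? parties m | p ∈? parties m′
  ... | yes p∈ | yes p∈′ = contradiction p∈′ (disjoint p∈)
  ... | yes p∈ | no _    = refl
  ... | no _   | yes _  = refl
  ... | no _   | no _   = refl

  Enables-cong : ∀ {x y m} → x ≗ y → Enables N x m → Enables N y m
  Enables-cong x≗y (m∈ , en) = m∈ , λ {p} p∈ → subst (_ ∈_) (x≗y p) (en p∈)

  -- Runs.

  infixr 5 _∷_

  -- Occurrence sequences acting on agent states as well; the final marking is
  -- only determined pointwise, for lack of function extensionality.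
  data Run (x : Marking N) (q : State Q) : List (Outcome N) → Marking N → State Q → Set ℓ where
    [_] : ∀ {y} → x ≗ y → Run x q [] y q
    _∷_ : ∀ {m t q₁ σ y q′} → Enables N x m × t ∈ˡ results m × δ m t q q₁ →
          Run (fire N x (m , t)) q₁ σ y q′ → Run x q ((m , t) ∷ σ) y q′

  Run-congˡ : ∀ {x x′ q σ y q′} → x ≗ x′ → Run x q σ y q′ → Run x′ q σ y q′
  Run-congˡ e [ f ] = [ (λ p → trans (sym (e p)) (f p)) ]
  Run-congˡ e ((en , t∈ , d) ∷ run) =
    (Enables-cong e en , t∈ , d) ∷ Run-congˡ (fire-cong _ e) run

  Run-congʳ : ∀ {x q σ y y′ q′} → y ≗ y′ → Run x q σ y q′ → Run x q σ y′ q′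
  Run-congʳ e [ f ]       = [ (λ p → trans (f p) (e p)) ]
  Run-congʳ e (s ∷ run) = s ∷ Run-congʳ e run

  Run-++ : ∀ {x q σ y q′ τ z q″} → Run x q σ y q′ → Run y q′ τ z q″ → Run x q (σ ++ τ) z q″
  Run-++ [ e ] run′       = Run-congˡ (λ p → sym (e p)) run′
  Run-++ (s ∷ run) run′ = s ∷ Run-++ run run′

  Run-∷ʳ : ∀ {x q σ y q′ m t q″} → Run x q σ y q′ →
           Enables N y m × t ∈ˡ results m × δ m t q′ q″ →
           Run x q (σ ∷ʳ (m , t)) (fire N y (m , t)) q″
  Run-∷ʳ run s = Run-++ run (s ∷ [ (λ _ → refl) ])

  Run-unsnoc : ∀ {x q} σ {m t z q″} → Run x q (σ ∷ʳ (m , t)) z q″ →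
               ∃₂ λ y q′ → Run x q σ y q′ × (Enables N y m × t ∈ˡ results m × δ m t q′ q″) ×
                           fire N y (m , t) ≗ z
  Run-unsnoc []      (s ∷ [ e ]) = _ , _ , [ (λ _ → refl) ] , s , e
  Run-unsnoc (_ ∷ σ) (s ∷ run) =
    let y , q′ , run′ , rest = Run-unsnoc σ run in y , q′ , s ∷ run′ , rest

  Occurs⇒Run : ∀ {x σ y q q′} → Occurs N x σ y → ⟦_⟧ N σ q q′ → Run x q σ y q′
  Occurs⇒Run [] refl = [ (λ _ → refl) ]
  Occurs⇒Run ((en , t∈) ∷ occ) (_ , d , ds) = (en , t∈ , d) ∷ Occurs⇒Run occ ds

  Run⇒Occurs : ∀ {x σ y q q′} → Run x q σ y q′ →
               ∃ λ y′ → Occurs N x σ y′ × y′ ≗ y × ⟦_⟧ N σ q q′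
  Run⇒Occurs [ e ] = _ , [] , e , refl
  Run⇒Occurs ((en , t∈ , d) ∷ run) =
    let y′ , occ , e , ds = Run⇒Occurs run in y′ , (en , t∈) ∷ occ , e , (_ , d , ds)

  -- The outcomes determine the markings, so the common prefix cancels.
  Occurs-++⁻ : ∀ {x σ x′ τ y} → Occurs N x σ x′ → Occurs N x (σ ++ τ) y → Occurs N x′ τ y
  Occurs-++⁻ [] occ = occ
  Occurs-++⁻ (_ ∷ occ) (_ ∷ occ′) = Occurs-++⁻ occ occ′

  IsFinal-cong : ∀ {x y} → x ≗ y → IsFinal N x → IsFinal N y
  IsFinal-cong e fin p = trans (sym (e p)) (fin p)

  -- The agent `p` must leave `m` before a final marking is reached, and the first atom with party
  -- `p` to occur can only be `m`; just before that, `m` is enabled.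
  singleton⇒enabled : ∀ {x q σ y q′ p m} → x p ≡ ⁅ m ⁆ → Run x q σ y q′ → IsFinal N y →
                      ∃ λ σ′ → ∃₂ λ z q″ → Run x q σ′ z q″ × Enables N z m
  singleton⇒enabled {p = p} xp [ e ] fin =
    contradiction (trans (sym xp) (trans (e p) (fin p))) ⁅x⁆≢⊥
  singleton⇒enabled {x} {p = p} {m} xp (_∷_ {m = m′} s@(en , _) run) fin with p ∈? parties m′
  ... | yes p∈ = case x∈⁅y⁆⇒x≡y m (subst (m′ ∈_) xp (proj₂ en p∈)) of λ where
                   refl → _ , _ , _ , [ (λ _ → refl) ] , en
  ... | no p∉ =
    let _ , _ , _ , run′ , en′ = singleton⇒enabled (trans (fire-∉ x p∉) xp) run fin
    in _ , _ , _ , s ∷ run′ , en′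

  Summary-intro : ∀ {m σ t y q q′} → m ≡ nf → Run (initial N) q (σ ∷ʳ (m , t)) y q′ →
                  IsFinal N y → Summary N t q q′
  Summary-intro refl run fin =
    let y′ , occ , e , ds = Run⇒Occurs run
    in _ , (y′ , occ , IsFinal-cong (λ p → sym (e p)) fin) , ds

  Summary-elim : ∀ {t q q′} → Summary N t q q′ →
                 ∃₂ λ σ y → Run (initial N) q (σ ∷ʳ (nf , t)) y q′ × IsFinal N y
  Summary-elim (σ , (y , occ , fin) , ds) = σ , y , Occurs⇒Run occ ds , fin

  -- Soundness in terms of runs.

  Inside : Marking N → Set
  Inside x = ∀ p → x p ⊆ atoms

  module _ (isN : IsNegotiation N) where
    open IsNegotiation isN

    -- Left-totality of the transformers lets every occurrence sequence be lifted to a run.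
    Occurs-total : ∀ {x σ y} → Occurs N x σ y → ∀ q → ∃ λ q′ → ⟦_⟧ N σ q q′
    Occurs-total [] q = q , refl
    Occurs-total ((en , t∈) ∷ occ) q =
      let q₁ , d  = IsTransformerOn.left-total (δ-transformer (proj₁ en , t∈)) q
          q′ , ds = Occurs-total occ q₁
      in q′ , q₁ , d , ds

    Inside-initial : Inside (initial N)
    Inside-initial p m∈ = subst (_∈ atoms) (sym (x∈⁅y⁆⇒x≡y n₀ m∈)) n₀∈atoms

    Run-Inside : ∀ {x q σ y q′} → Inside x → Run x q σ y q′ → Inside y
    Run-Inside ins [ e ] p m∈ = ins p (subst (_ ∈_) (sym (e p)) m∈)
    Run-Inside {x} ins (_∷_ {m = m} {t} (en , t∈ , _) run) = Run-Inside ins′ run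
      where
        ins′ : Inside (fire N x (m , t))
        ins′ p v∈ with p ∈? parties m
        ... | yes p∈ = X⊆atoms (proj₁ en , p∈ , t∈) v∈
        ... | no _   = ins p v∈

    module _ (q₀ : State Q) where

      -- Soundness in the form that a simulation of runs can use. The start state `q₀` is arbitrary,
      -- since occurrence sequences lift to runs from any state.
      record RunSound : Set ℓ where
        field
          enabled     : ∀ {m} → m ∈ atoms →
                        ∃ λ σ → ∃₂ λ x q → Run (initial N) q₀ σ x q × Enables N x m
          completable : ∀ {σ x q} → Run (initial N) q₀ σ x q →
                        ∃ λ τ → ∃₂ λ y q′ → Run x q τ y q′ × IsFinal N y

      Sound⇔RunSound : Sound N ↔ᵖ RunSound
      Sound⇔RunSound = mk⇔
        (λ sound → record
          { enabled = λ m∈ →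
              let x , (σ , occ) , en = Sound.enabled sound m∈
                  q , ds = Occurs-total occ q₀
              in σ , x , q , Occurs⇒Run occ ds , en
          ; completable = λ {q = q} run →
              let _ , occ , e , _ = Run⇒Occurs run
                  τ , y , occ′ , fin = Sound.completable sound occ
                  occ″ = Occurs-++⁻ occ occ′
                  q′ , ds = Occurs-total occ″ q
              in τ , y , q′ , Run-congˡ e (Occurs⇒Run occ″ ds) , fin
          })
        (λ sound → record
          { enabled = λ m∈ →
              let σ , x , q , run , en = RunSound.enabled sound m∈
                  x′ , occ , e , _ = Run⇒Occurs run
              in x′ , (σ , occ) , Enables-cong (λ p → sym (e p)) en
          ; completable = λ {σ} occ →
              let q , ds = Occurs-total occ q₀
                  run = Occurs⇒Run occ ds
                  τ , y , q′ , run′ , fin = RunSound.completable sound run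
                  y′ , occ′ , e , _ = Run⇒Occurs (Run-++ run run′)
              in τ , y′ , occ′ , IsFinal-cong (λ p → sym (e p)) fin
          })

module ShortcutCorrectness {ℓ : Level} {a k : ℕ} {Q : Fin a → Set ℓ} (N₁ N₂ : Net Q k)
                           (isN₁ : IsNegotiation N₁) (S : Shortcut N₁ N₂) where
  open Shortcut S
  open Equivalence using (to; from)
  private
    module N₁ = Net N₁
    module N₂ = Net N₂
    module I₁ = IsNegotiation isN₁

  -- Consequences of the guard.

  Exclusive : Set
  Exclusive = ExclusiveAccess N₁ (n , r) n′

  n∈₁ : n ∈ N₁.atoms
  n∈₁ = proj₁ outcome

  -- Membership in a finite subset is decidable, and the second component is a negation.
  Exclusive-stable : ¬ ¬ Exclusive → Exclusive
  Exclusive-stable ¬¬ex {p} p∈ =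
    decidable-stable (n′ ∈? N₁.X n p r) (λ n′∉ → ¬¬ex λ ex → n′∉ (proj₁ (ex p∈))) ,
    λ T₁ ≢nr n′∈X → ¬¬ex λ ex → proj₂ (ex p∈) T₁ ≢nr n′∈X

  exclusive⇒∉ : Exclusive → n′ ∉ N₂.atoms
  exclusive⇒∉ ex n′∈₂ = x∉p-x N₁.atoms (subst (n′ ∈_) (atoms-removed ex) n′∈₂)

  -- Membership of n′ in N₂ decides the matter, as Exclusive is ¬¬-stable.
  exclusive? : Dec Exclusive
  exclusive? with n′ ∈? N₂.atoms
  ... | yes n′∈₂ = no λ ex → exclusive⇒∉ ex n′∈₂
  ... | no n′∉₂  = yes (Exclusive-stable λ ¬ex →
                     n′∉₂ (subst (n′ ∈_) (sym (atoms-kept ¬ex)) n′∈))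

  atoms₂⊆₁ : N₂.atoms ⊆ N₁.atoms
  atoms₂⊆₁ {m} m∈ with exclusive?
  ... | yes ex = p─q⊆p N₁.atoms ⁅ n′ ⁆ (subst (m ∈_) (atoms-removed ex) m∈)
  ... | no ¬ex = subst (m ∈_) (atoms-kept ¬ex) m∈

  ∈₁⇒∈₂ : ∀ {m} → m ≢ n′ → m ∈ N₁.atoms → m ∈ N₂.atoms
  ∈₁⇒∈₂ {m} m≢n′ m∈ with exclusive?
  ... | yes ex = subst (m ∈_) (sym (atoms-removed ex)) (x∈p∧x≢y⇒x∈p-y m∈ m≢n′)
  ... | no ¬ex = subst (m ∈_) (sym (atoms-kept ¬ex)) m∈

  n∈₂ : n ∈ N₂.atoms
  n∈₂ = ∈₁⇒∈₂ (n′≢n ∘ sym) n∈₁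

  parties₂⇒₁ : ∀ {m p} → m ∈ N₂.atoms → p ∈ N₂.parties m → p ∈ N₁.parties m
  parties₂⇒₁ m∈ = subst (_ ∈_) (parties-same m∈)

  parties₁⇒₂ : ∀ {m p} → m ∈ N₂.atoms → p ∈ N₁.parties m → p ∈ N₂.parties m
  parties₁⇒₂ m∈ = subst (_ ∈_) (sym (parties-same m∈))

  parties-n′⊆n : N₁.parties n′ ⊆ N₁.parties n
  parties-n′⊆n = proj₁ enables

  X-n : ∀ {p} → p ∈ N₁.parties n′ → N₁.X n p r ≡ ⁅ n′ ⁆
  X-n = proj₂ enables

  agent′ : Fin a
  agent′ = proj₁ (I₁.parties-nonempty n′∈)

  agent′∈ : agent′ ∈ N₁.parties n′
  agent′∈ = proj₂ (I₁.parties-nonempty n′∈)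

  agent′∈n : agent′ ∈ N₁.parties n
  agent′∈n = parties-n′⊆n agent′∈

  result′ : ∃ λ t → t ∈ˡ N₁.results n′
  result′ = I₁.results-nonempty n′∈

  -- `X n agent′ r` contains `n′`, whereas the final atom sends its parties to the empty set.
  n≢nf : n ≢ N₁.nf
  n≢nf n≡nf = ⁅x⁆≢⊥ (trans (sym (X-n agent′∈))
                           (from (I₁.X-empty (n∈₁ , agent′∈n , proj₂ outcome)) n≡nf))

  final⇒exclusive : n′ ≡ N₁.nf → Exclusive
  final⇒exclusive n′≡nf with guard
  ... | inj₁ (n′≢nf , _)            = contradiction n′≡nf n′≢nf
  ... | inj₂ (inj₁ (n′≢nf , _))     = contradiction n′≡nf n′≢nf
  ... | inj₂ (inj₂ (_ , ex , _))    = ex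

  final⇒only-result : n′ ≡ N₁.nf → ∀ {t} → t ∈ˡ N₁.results n → t ≡ r
  final⇒only-result n′≡nf with guard
  ... | inj₁ (n′≢nf , _)            = contradiction n′≡nf n′≢nf
  ... | inj₂ (inj₁ (n′≢nf , _))     = contradiction n′≡nf n′≢nf
  ... | inj₂ (inj₂ (_ , _ , only))  = only

  final⇒all-parties : n′ ≡ N₁.nf → ∀ {p} → p ∈ N₁.parties n′
  final⇒all-parties n′≡nf {p} =
    subst (λ m → p ∈ N₁.parties m) (sym n′≡nf) (subst (p ∈_) (sym I₁.parties-nf) ∈⊤)

  -- The other two alternatives of the guard include exclusive access, which removes `n′`.
  kept⇒committed : n′ ∈ N₂.atoms →
                   ∃ λ o → IsOutcome N₁ o × o ≢ (n , r) × CommitsTo N₁ o n′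
  kept⇒committed n′∈₂ with guard
  ... | inj₁ (_ , ex)              = contradiction n′∈₂ (exclusive⇒∉ ex)
  ... | inj₂ (inj₁ (_ , commits))  = commits
  ... | inj₂ (inj₂ (_ , ex , _))   = contradiction n′∈₂ (exclusive⇒∉ ex)

  nf-new : n′ ≡ N₁.nf → n ≡ N₂.nf
  nf-new n′≡nf = sym (nf-removed (n′≡nf , final⇒exclusive n′≡nf))

  nf-old : n′ ≢ N₁.nf → N₁.nf ≡ N₂.nf
  nf-old n′≢nf = sym (nf-kept (n′≢nf ∘ proj₁))

  -- Only `n′` can be missing from `N₂`, and then only `(n , r)` leads to it. By `X-party`, an agent
  -- `p` sent to `n′` is one of its parties, so exclusive access applies to `p`.
  target∈₂ : ∀ {m p u v} → T N₁ (m , p , u) → (m , u) ≢ (n , r) →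
             v ∈ N₁.X m p u → v ∈ N₂.atoms
  target∈₂ {v = v} T₁ ≢nr v∈ with v ≟ n′ | exclusive?
  ... | no v≢n′  | _      = ∈₁⇒∈₂ v≢n′ (I₁.X⊆atoms T₁ v∈)
  ... | yes refl | yes ex = contradiction v∈ (proj₂ (ex (I₁.X-party T₁ v∈)) T₁ ≢nr)
  ... | yes refl | no ¬ex = subst (n′ ∈_) (sym (atoms-kept ¬ex)) n′∈

  -- By `X-party`, an agent that is not a party of `n′` is never sent to `n′`, the only atom that
  -- may have been removed.
  target-n∈₂ : ∀ {p v} → p ∈ N₁.parties n → p ∉ N₁.parties n′ →
               v ∈ N₁.X n p r → v ∈ N₂.atoms
  target-n∈₂ p∈ p∉ v∈ =
    ∈₁⇒∈₂ (λ where refl → p∉ (I₁.X-party T₁ v∈)) (I₁.X⊆atoms T₁ v∈)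
    where T₁ = n∈₁ , p∈ , proj₂ outcome

  -- Outcomes and edges of `N₂`.

  data Origin : Fin k → ℕ → Set where
    old : ∀ {m u} → u ∈ˡ N₁.results m → (m , u) ≢ (n , r) → Origin m u
    new : ∀ {t} → t ∈ˡ N₁.results n′ → Origin n (s t)

  origin : ∀ {m u} → m ∈ N₂.atoms → u ∈ˡ N₂.results m → Origin m u
  origin {m} {u} m∈ u∈ with m ≟ n
  ... | no m≢n = old (to (results-≢ m∈ m≢n) u∈) (m≢n ∘ cong proj₁)
  ... | yes refl with ∈-++⁻ (filter (λ t → ¬? (t ℕ.≟ r)) (N₁.results n)) (to results-n u∈)
  ...   | inj₁ u∈₁ = let u∈′ , u≢r = ∈-filter⁻ (λ t → ¬? (t ℕ.≟ r)) u∈₁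
                     in old u∈′ (u≢r ∘ cong proj₂)
  ...   | inj₂ u∈₂ with ∈-map⁻ s u∈₂
  ...     | t , t∈ , refl = new t∈

  old-result : ∀ {m u} → m ∈ N₂.atoms → u ∈ˡ N₁.results m → (m , u) ≢ (n , r) →
               u ∈ˡ N₂.results m
  old-result {m} {u} m∈ u∈ ≢nr with m ≟ n
  ... | no m≢n   = from (results-≢ m∈ m≢n) u∈
  ... | yes refl = from results-n (∈-++⁺ˡ (∈-filter⁺ (λ t → ¬? (t ℕ.≟ r)) u∈ (≢nr ∘ cong (n ,_))))

  new-result : ∀ {t} → t ∈ˡ N₁.results n′ → s t ∈ˡ N₂.results n
  new-result t∈ = from results-n (∈-++⁺ʳ _ (∈-map⁺ s t∈))

  Edge₂-old : ∀ {m p u v} → m ∈ N₂.atoms → T N₁ (m , p , u) → (m , u) ≢ (n , r) →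
              v ∈ N₁.X m p u → Edge N₂ m v
  Edge₂-old {v = v} m∈ (_ , p∈ , u∈) ≢nr v∈ =
    _ , _ , (m∈ , parties₁⇒₂ m∈ p∈ , old-result m∈ u∈ ≢nr) ,
    subst (v ∈_) (sym (X-old m∈ u∈ ≢nr p∈)) v∈

  Edge₂-n : ∀ {p v} → p ∈ N₁.parties n → p ∉ N₁.parties n′ → v ∈ N₁.X n p r → Edge N₂ n v
  Edge₂-n {v = v} p∈ p∉ v∈ =
    _ , _ , (n∈₂ , parties₁⇒₂ n∈₂ p∈ , new-result (proj₂ result′)) ,
    subst (v ∈_) (sym (X-new₂ (proj₂ result′) p∈ p∉)) v∈

  Edge₂-n′ : ∀ {p t v} → T N₁ (n′ , p , t) → v ∈ N₁.X n′ p t → Edge N₂ n v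
  Edge₂-n′ {v = v} (_ , p∈ , t∈) v∈ =
    _ , _ , (n∈₂ , parties₁⇒₂ n∈₂ (parties-n′⊆n p∈) , new-result t∈) ,
    subst (v ∈_) (sym (X-new₁ t∈ p∈)) v∈

  -- Rerouting paths of `N₁` in `N₂`.

  _≟ᵒ_ : (o o′ : Fin k × ℕ) → Dec (o ≡ o′)
  _≟ᵒ_ = ≡-dec _≟_ ℕ._≟_

  -- A path of N₁ standing at n′ after (n , r) corresponds to one of N₂ still standing at n.
  data Reached (m : Fin k) : Set where
    at      : m ∈ N₂.atoms → Star (Edge N₂) N₁.n₀ m → Reached m
    delayed : m ≡ n′ → Star (Edge N₂) N₁.n₀ n → Reached m

  Reached-step : ∀ {m m′} → Reached m → Edge N₁ m m′ → Reached m′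
  Reached-step (at m∈ path) (p , u , T₁@(_ , p∈ , _) , v∈) with (_ , u) ≟ᵒ (n , r)
  ... | no ≢nr   = at (target∈₂ T₁ ≢nr v∈) (path ◅◅ Edge₂-old m∈ T₁ ≢nr v∈ ◅ ε)
  ... | yes refl with p ∈? N₁.parties n′
  ...   | yes p∈′ = delayed (x∈⁅y⁆⇒x≡y n′ (subst (_ ∈_) (X-n p∈′) v∈)) path
  ...   | no p∉   = at (target-n∈₂ p∈ p∉ v∈) (path ◅◅ Edge₂-n p∈ p∉ v∈ ◅ ε)
  Reached-step (delayed refl path) (_ , _ , T₁ , v∈) =
    at (target∈₂ T₁ (n′≢n ∘ cong proj₁) v∈) (path ◅◅ Edge₂-n′ T₁ v∈ ◅ ε)

  Reached-star : ∀ {m m′} → Reached m → Star (Edge N₁) m m′ → Reached m′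
  Reached-star rch ε        = rch
  Reached-star rch (e ◅ es) = Reached-star (Reached-step rch e) es

  n₀∈₂ : N₁.n₀ ∈ N₂.atoms
  n₀∈₂ with exclusive?
  ... | yes ex = ∈₁⇒∈₂ (n₀-kept ex ∘ sym) I₁.n₀∈atoms
  ... | no ¬ex = subst (N₁.n₀ ∈_) (sym (atoms-kept ¬ex)) I₁.n₀∈atoms

  stars₁ : ∀ {m} → m ∈ N₁.atoms → Star (Edge N₁) N₁.n₀ m × Star (Edge N₁) m N₁.nf
  stars₁ m∈ with I₁.on-path m∈
  ... | _ ∷ _ , (ts , ss , refl , eq) , m∈π = path⇒stars N₁ ts ss eq m∈π

  from-n₀ : ∀ {m} → m ∈ N₂.atoms → Star (Edge N₂) N₁.n₀ m
  from-n₀ m∈ with Reached-star (at n₀∈₂ ε) (proj₁ (stars₁ (atoms₂⊆₁ m∈)))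
  ... | at _ path = path
  -- Here `n′` survives, but the translated path has stopped at `n`. A different outcome committing
  -- to `n′` provides the missing edge: from its own atom if that was reached, or, if it is an
  -- outcome of `n′` itself, from `n` through the corresponding new result.
  ... | delayed refl path with kept⇒committed m∈
  ...   | (m″ , u) , (m″∈ , u∈) , ≢nr , (p , p∈ , X≡) with
            Reached-star (at n₀∈₂ ε) (proj₁ (stars₁ m″∈))
  ...     | at m″∈₂ path″      = path″ ◅◅ Edge₂-old m″∈₂ (m″∈ , p∈ , u∈) ≢nr n′∈X ◅ ε
    where n′∈X = subst (n′ ∈_) (sym X≡) (x∈⁅x⁆ n′)
  ...     | delayed refl path″ = path″ ◅◅ Edge₂-n′ (m″∈ , p∈ , u∈) n′∈X ◅ ε
    where n′∈X = subst (n′ ∈_) (sym X≡) (x∈⁅x⁆ n′)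

  -- In `N₂` a path of `N₁` leaving `n′` can be continued from `n`, so the two claims are proved
  -- together. A step from `n` to `n′` along `(n , r)` by a party of `n′` is dropped, and the path
  -- goes on from `n`.
  to-nf : ∀ {m} → Star (Edge N₁) m N₁.nf →
          (m ∈ N₂.atoms → Star (Edge N₂) m N₂.nf) × (m ≡ n′ → Star (Edge N₂) n N₂.nf)
  to-nf ε =
    (λ nf∈₂ → subst (Star (Edge N₂) N₁.nf)
                (nf-old λ n′≡nf → exclusive⇒∉ (final⇒exclusive n′≡nf)
                                    (subst (_∈ N₂.atoms) (sym n′≡nf) nf∈₂)) ε) ,
    (λ nf≡n′ → subst (Star (Edge N₂) n) (nf-new (sym nf≡n′)) ε)
  to-nf {m} (_◅_ {j = v} (p , u , T₁@(_ , p∈ , _) , v∈) path) = kept , λ where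
      refl → Edge₂-n′ T₁ v∈ ◅ proj₁ (to-nf path) (target∈₂ T₁ (n′≢n ∘ cong proj₁) v∈)
    where
      kept : m ∈ N₂.atoms → Star (Edge N₂) m N₂.nf
      kept m∈ with (m , u) ≟ᵒ (n , r)
      ... | no ≢nr   = Edge₂-old m∈ T₁ ≢nr v∈ ◅ proj₁ (to-nf path) (target∈₂ T₁ ≢nr v∈)
      ... | yes refl with p ∈? N₁.parties n′
      ...   | yes p∈′ = proj₂ (to-nf path) (x∈⁅y⁆⇒x≡y n′ (subst (v ∈_) (X-n p∈′) v∈))
      ...   | no p∉   = Edge₂-n p∈ p∉ v∈ ◅ proj₁ (to-nf path) (target-n∈₂ p∈ p∉ v∈)

  -- `N₂` is a negotiation.

  nf∈₂ : N₂.nf ∈ N₂.atoms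
  nf∈₂ with n′ ≟ N₁.nf
  ... | yes n′≡nf = subst (_∈ N₂.atoms) (nf-new n′≡nf) n∈₂
  ... | no n′≢nf  = subst (_∈ N₂.atoms) (nf-old n′≢nf) (∈₁⇒∈₂ (n′≢nf ∘ sym) I₁.nf∈atoms)

  nf-parties : ∀ {p} → p ∈ N₂.parties N₂.nf
  nf-parties {p} with n′ ≟ N₁.nf
  ... | yes n′≡nf = parties₁⇒₂ nf∈₂ (subst (λ m → p ∈ N₁.parties m) (nf-new n′≡nf)
                      (parties-n′⊆n (final⇒all-parties n′≡nf)))
  ... | no n′≢nf  = parties₁⇒₂ nf∈₂ (subst (λ m → p ∈ N₁.parties m) (nf-old n′≢nf)
                      (subst (p ∈_) (sym I₁.parties-nf) ∈⊤))

  n≡nf₂⇒n′≡nf : n ≡ N₂.nf → n′ ≡ N₁.nf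
  n≡nf₂⇒n′≡nf n≡nf₂ with n′ ≟ N₁.nf
  ... | yes n′≡nf = n′≡nf
  ... | no n′≢nf  = contradiction (trans n≡nf₂ (sym (nf-old n′≢nf))) n≢nf

  -- If the final atom `n′` is removed, both sides fail: a surviving `m` is not `n′`, and the new
  -- final atom `n` had `r` as its only result in `N₁`.
  old-nf : ∀ {m u} → m ∈ N₂.atoms → u ∈ˡ N₁.results m → (m , u) ≢ (n , r) →
           m ≡ N₁.nf ↔ᵖ m ≡ N₂.nf
  old-nf m∈ u∈ ≢nr with n′ ≟ N₁.nf
  ... | no n′≢nf  = mk⇔ (λ eq → trans eq (nf-old n′≢nf)) (λ eq → trans eq (sym (nf-old n′≢nf)))
  ... | yes n′≡nf = mk⇔
    (λ m≡nf → contradiction (subst (_∈ N₂.atoms) (trans m≡nf (sym n′≡nf)) m∈)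
                            (exclusive⇒∉ (final⇒exclusive n′≡nf)))
    (λ m≡nf₂ → case trans m≡nf₂ (sym (nf-new n′≡nf)) of λ where
      refl → contradiction (cong (n ,_) (final⇒only-result n′≡nf u∈)) ≢nr)

  isN₂ : IsNegotiation N₂
  isN₂ = record
    { n₀∈atoms         = subst (_∈ N₂.atoms) (sym n₀-same) n₀∈₂
    ; nf∈atoms         = nf∈₂
    ; parties-nonempty = λ m∈ → let p , p∈ = I₁.parties-nonempty (atoms₂⊆₁ m∈)
                                in p , parties₁⇒₂ m∈ p∈
    ; results-nonempty = results-nonempty
    ; δ-transformer    = λ (m∈ , u∈) → δ-transformer m∈ (origin m∈ u∈)
    ; X⊆atoms          = λ (m∈ , p∈ , u∈) → X⊆atoms m∈ p∈ (origin m∈ u∈)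
    ; X-party          = λ T₂@(m∈ , p∈ , u∈) v∈ →
        parties₁⇒₂ (X⊆atoms m∈ p∈ (origin m∈ u∈) v∈) (X-party m∈ p∈ (origin m∈ u∈) v∈)
    ; parties-n₀       = trans (cong N₂.parties n₀-same)
                               (trans (parties-same n₀∈₂) I₁.parties-n₀)
    ; parties-nf       = ⊆-antisym ⊆⊤ (λ _ → nf-parties)
    ; X-empty          = λ (m∈ , p∈ , u∈) → X-empty m∈ p∈ (origin m∈ u∈)
    ; on-path          = λ {m} m∈ → stars⇒path N₂
        (nf∈₂ , nf-parties {agent′} , proj₂ (results-nonempty nf∈₂))
        (subst (λ m₀ → Star (Edge N₂) m₀ m) (sym n₀-same) (from-n₀ m∈))
        (proj₁ (to-nf (proj₂ (stars₁ (atoms₂⊆₁ m∈)))) m∈)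
    }
    where
      results-nonempty : ∀ {m} → m ∈ N₂.atoms → ∃ λ u → u ∈ˡ N₂.results m
      results-nonempty {m} m∈ with m ≟ n
      ... | yes refl = _ , new-result (proj₂ result′)
      ... | no m≢n   = let u , u∈ = I₁.results-nonempty (atoms₂⊆₁ m∈)
                       in u , old-result m∈ u∈ (m≢n ∘ cong proj₁)

      δ-transformer : ∀ {m u} → m ∈ N₂.atoms → Origin m u →
                      IsTransformerOn Q (N₂.parties m) (N₂.δ m u)
      δ-transformer {m} {u} m∈ o =
        subst (λ P → IsTransformerOn Q P (N₂.δ m u)) (sym (parties-same m∈)) (helper o)
        where
          helper : Origin m u → IsTransformerOn Q (N₁.parties m) (N₂.δ m u)
          helper (old u∈ ≢nr) = transformer-resp-≐ (δ-old m∈ u∈ ≢nr)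
                                  (I₁.δ-transformer (atoms₂⊆₁ m∈ , u∈))
          helper (new t∈)     = transformer-resp-≐ (δ-new t∈)
                                  (transformer-∘ parties-n′⊆n (I₁.δ-transformer outcome)
                                                 (I₁.δ-transformer (n′∈ , t∈)))

      X⊆atoms : ∀ {m p u} → m ∈ N₂.atoms → p ∈ N₂.parties m → Origin m u →
                N₂.X m p u ⊆ N₂.atoms
      X⊆atoms m∈ p∈₂ (old u∈ ≢nr) v∈ =
        target∈₂ (atoms₂⊆₁ m∈ , p∈ , u∈) ≢nr (subst (_ ∈_) (X-old m∈ u∈ ≢nr p∈) v∈)
        where p∈ = parties₂⇒₁ m∈ p∈₂
      X⊆atoms {p = p} m∈ p∈₂ (new t∈) v∈ with p ∈? N₁.parties n′
      ... | yes p∈′ = target∈₂ (n′∈ , p∈′ , t∈) (n′≢n ∘ cong proj₁)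
                               (subst (_ ∈_) (X-new₁ t∈ p∈′) v∈)
      ... | no p∉   = target-n∈₂ p∈ p∉ (subst (_ ∈_) (X-new₂ t∈ p∈ p∉) v∈)
        where p∈ = parties₂⇒₁ n∈₂ p∈₂

      X-party : ∀ {m p u v} → m ∈ N₂.atoms → p ∈ N₂.parties m → Origin m u →
                v ∈ N₂.X m p u → p ∈ N₁.parties v
      X-party m∈ p∈₂ (old u∈ ≢nr) v∈ =
        I₁.X-party (atoms₂⊆₁ m∈ , p∈ , u∈) (subst (_ ∈_) (X-old m∈ u∈ ≢nr p∈) v∈)
        where p∈ = parties₂⇒₁ m∈ p∈₂
      X-party {p = p} m∈ p∈₂ (new t∈) v∈ with p ∈? N₁.parties n′
      ... | yes p∈′ = I₁.X-party (n′∈ , p∈′ , t∈) (subst (_ ∈_) (X-new₁ t∈ p∈′) v∈)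
      ... | no p∉   = I₁.X-party (n∈₁ , p∈ , proj₂ outcome)
                                 (subst (_ ∈_) (X-new₂ t∈ p∈ p∉) v∈)
        where p∈ = parties₂⇒₁ n∈₂ p∈₂

      X-empty : ∀ {m p u} → m ∈ N₂.atoms → p ∈ N₂.parties m → Origin m u →
                N₂.X m p u ≡ ⊥ ↔ᵖ m ≡ N₂.nf
      X-empty m∈ p∈₂ (old u∈ ≢nr) = mk⇔
        (λ X≡⊥ → to (old-nf m∈ u∈ ≢nr) (to emp₁ (trans (sym X≡) X≡⊥)))
        (λ m≡nf₂ → trans X≡ (from emp₁ (from (old-nf m∈ u∈ ≢nr) m≡nf₂)))
        where
          p∈ = parties₂⇒₁ m∈ p∈₂
          X≡ = X-old m∈ u∈ ≢nr p∈
          emp₁ = I₁.X-empty (atoms₂⊆₁ m∈ , p∈ , u∈)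
      X-empty {p = p} m∈ p∈₂ (new t∈) with p ∈? N₁.parties n′
      ... | yes p∈′ = mk⇔
        (λ X≡⊥ → nf-new (to emp₁ (trans (sym (X-new₁ t∈ p∈′)) X≡⊥)))
        (λ n≡nf₂ → trans (X-new₁ t∈ p∈′) (from emp₁ (n≡nf₂⇒n′≡nf n≡nf₂)))
        where emp₁ = I₁.X-empty (n′∈ , p∈′ , t∈)
      -- Both sides fail: `n` is not final in `N₁`, so `X n p r` is nonempty; and if `n` were final
      -- in `N₂`, then `n′` would be final in `N₁` and have `p` as a party.
      ... | no p∉ = mk⇔
        (λ X≡⊥ → contradiction (to (I₁.X-empty (n∈₁ , p∈ , proj₂ outcome))
                                   (trans (sym (X-new₂ t∈ p∈ p∉)) X≡⊥)) n≢nf)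
        (λ n≡nf₂ → contradiction (final⇒all-parties (n≡nf₂⇒n′≡nf n≡nf₂)) p∉)
        where p∈ = parties₂⇒₁ n∈₂ p∈₂

  -- Unfolding runs of `N₂` into runs of `N₁`.

  fire-old : ∀ x {m u} → m ∈ N₂.atoms → u ∈ˡ N₁.results m → (m , u) ≢ (n , r) →
             fire N₂ x (m , u) ≗ fire N₁ x (m , u)
  fire-old x {m} m∈ u∈ ≢nr p with p ∈? N₁.parties m
  ... | yes p∈ = trans (fire-∈ N₂ x (parties₁⇒₂ m∈ p∈)) (X-old m∈ u∈ ≢nr p∈)
  ... | no p∉  = fire-∉ N₂ x (p∉ ∘ parties₂⇒₁ m∈)

  fire-new : ∀ x {t} → t ∈ˡ N₁.results n′ →
             fire N₂ x (n , s t) ≗ fire N₁ (fire N₁ x (n , r)) (n′ , t)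
  fire-new x t∈ p with p ∈? N₁.parties n′ | p ∈? N₁.parties n
  ... | yes p∈′ | _      = trans (fire-∈ N₂ x (parties₁⇒₂ n∈₂ (parties-n′⊆n p∈′))) (X-new₁ t∈ p∈′)
  ... | no p∉′  | yes p∈ = trans (fire-∈ N₂ x (parties₁⇒₂ n∈₂ p∈)) (X-new₂ t∈ p∈ p∉′)
  ... | no _    | no p∉  = fire-∉ N₂ x (p∉ ∘ parties₂⇒₁ n∈₂)

  Enables₂⇒₁ : ∀ {x m} → Enables N₂ x m → Enables N₁ x m
  Enables₂⇒₁ (m∈ , en) = atoms₂⊆₁ m∈ , en ∘ parties₁⇒₂ m∈

  Enables₁⇒₂ : ∀ {x m} → m ∈ N₂.atoms → Enables N₁ x m → Enables N₂ x m
  Enables₁⇒₂ m∈ (_ , en) = m∈ , en ∘ parties₂⇒₁ m∈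

  initial-same : initial N₁ ≗ initial N₂
  initial-same _ = cong ⁅_⁆ (sym n₀-same)

  nr-enables-n′ : ∀ x → Enables N₁ (fire N₁ x (n , r)) n′
  nr-enables-n′ x = n′∈ , λ p∈ →
    subst (n′ ∈_) (sym (trans (fire-∈ N₁ x (parties-n′⊆n p∈)) (X-n p∈))) (x∈⁅x⁆ n′)

  Run₁-old : ∀ {x m u q q′} → Enables N₂ x m → u ∈ˡ N₁.results m → (m , u) ≢ (n , r) →
             N₂.δ m u q q′ → Run N₁ x q ((m , u) ∷ []) (fire N₂ x (m , u)) q′
  Run₁-old {x} en u∈ ≢nr d =
    (Enables₂⇒₁ en , u∈ , proj₁ (δ-old (proj₁ en) u∈ ≢nr) d) ∷
    [ (λ p → sym (fire-old x (proj₁ en) u∈ ≢nr p)) ]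

  Run₁-new : ∀ {x t q q′} → Enables N₂ x n → t ∈ˡ N₁.results n′ → N₂.δ n (s t) q q′ →
             Run N₁ x q ((n , r) ∷ (n′ , t) ∷ []) (fire N₂ x (n , s t)) q′
  Run₁-new {x} en t∈ d with proj₁ (δ-new t∈) d
  ... | _ , d₁ , d₂ =
    (Enables₂⇒₁ en , proj₂ outcome , d₁) ∷ (nr-enables-n′ x , t∈ , d₂) ∷
    [ (λ p → sym (fire-new x t∈ p)) ]

  expand : ∀ {x q σ y q′} → Run N₂ x q σ y q′ → ∃ λ σ₁ → Run N₁ x q σ₁ y q′
  expand [ e ] = _ , [ e ]
  expand ((en , u∈ , d) ∷ run) with origin (proj₁ en) u∈ | expand run
  ... | old u∈₁ ≢nr | _ , run₁ = _ , Run-++ N₁ (Run₁-old en u∈₁ ≢nr d) run₁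
  ... | new t∈      | _ , run₁ = _ , Run-++ N₁ (Run₁-new en t∈ d) run₁

  -- Simulation of `N₁` by `N₂`.

  module Simulation (x₀ : Marking N₁) (q₀ : State Q) (inside₀ : Inside N₂ x₀) where

    -- After a run of N₁, either N₂ can reach the same marking, or (n , r) has occurred
    -- and n′ has not followed yet, and N₂ can reach whatever n′ leads to.
    data Sim (x : Marking N₁) (q : State Q) : Set ℓ where
      synced  : ∀ {σ} → Run N₂ x₀ q₀ σ x q → Sim x q
      pending : (∀ {p} → p ∈ N₁.parties n′ → x p ≡ ⁅ n′ ⁆) →
                (∀ {t q′} → t ∈ˡ N₁.results n′ → N₁.δ n′ t q q′ →
                   ∃ λ σ → Run N₂ x₀ q₀ σ (fire N₁ x (n′ , t)) q′ ×
                           (n′ ≡ N₁.nf → ∃ λ σ′ → σ ≡ σ′ ∷ʳ (n , s t))) →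
                Sim x q

    Sim-cong : ∀ {x y q} → x ≗ y → Sim x q → Sim y q
    Sim-cong e (synced run) = synced (Run-congʳ N₂ e run)
    Sim-cong e (pending at-n′ runs) = pending
      (λ p∈ → trans (sym (e _)) (at-n′ p∈))
      (λ t∈ d → let σ , run , l = runs t∈ d in σ , Run-congʳ N₂ (fire-cong N₁ _ e) run , l)

    -- Markings reached in `N₂` mention only atoms of `N₂`, and an enabled atom occurs in the
    -- marking of each of its parties, of which there is at least one.
    enabled⇒∈₂ : ∀ {σ x q m} → Run N₂ x₀ q₀ σ x q → Enables N₁ x m → m ∈ N₂.atoms
    enabled⇒∈₂ run (m∈ , en) =
      let p , p∈ = I₁.parties-nonempty m∈ in Run-Inside N₂ isN₂ inside₀ run p (en p∈)

    pending⇒disjoint : ∀ {x m} → (∀ {p} → p ∈ N₁.parties n′ → x p ≡ ⁅ n′ ⁆) →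
                       Enables N₁ x m → m ≢ n′ → ∀ {p} → p ∈ N₁.parties m → p ∉ N₁.parties n′
    pending⇒disjoint at-n′ (_ , en) m≢n′ p∈ p∈′ =
      m≢n′ (x∈⁅y⁆⇒x≡y n′ (subst (_ ∈_) (at-n′ p∈′) (en p∈)))

    enabled-after-n′ : ∀ {x m t} → (∀ {p} → p ∈ N₁.parties m → p ∉ N₁.parties n′) →
                       Enables N₁ x m → Enables N₁ (fire N₁ x (n′ , t)) m
    enabled-after-n′ {x} disjoint (m∈ , en) =
      m∈ , λ p∈ → subst (_ ∈_) (sym (fire-∉ N₁ x (disjoint p∈))) (en p∈)

    Run₂-old : ∀ {σ x q m u q′} → Run N₂ x₀ q₀ σ x q → Enables N₁ x m → u ∈ˡ N₁.results m →
               (m , u) ≢ (n , r) → N₁.δ m u q q′ →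
               Run N₂ x₀ q₀ (σ ∷ʳ (m , u)) (fire N₁ x (m , u)) q′
    Run₂-old {x = x} run en u∈ ≢nr d =
      Run-congʳ N₂ (fire-old x m∈ u∈ ≢nr)
        (Run-∷ʳ N₂ run (Enables₁⇒₂ m∈ en , old-result m∈ u∈ ≢nr , proj₂ (δ-old m∈ u∈ ≢nr) d))
      where m∈ = enabled⇒∈₂ run en

    Sim-step : ∀ {x q m u q′} → Sim x q → Enables N₁ x m → u ∈ˡ N₁.results m →
               N₁.δ m u q q′ → Sim (fire N₁ x (m , u)) q′
    Sim-step {x} {m = m} {u} (synced run) en u∈ d with (m , u) ≟ᵒ (n , r)
    ... | no ≢nr   = synced (Run₂-old run en u∈ ≢nr d)
    ... | yes refl = pending
      (λ p∈ → trans (fire-∈ N₁ x (parties-n′⊆n p∈)) (X-n p∈))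
      (λ t∈ d′ → _ ,
         Run-congʳ N₂ (fire-new x t∈)
           (Run-∷ʳ N₂ run (Enables₁⇒₂ n∈₂ en , new-result t∈ , proj₂ (δ-new t∈) (_ , d , d′))) ,
         λ _ → _ , refl)
    Sim-step {x} {m = m} {u} (pending at-n′ runs) en u∈ d with m ≟ n′
    ... | yes refl = synced (proj₁ (proj₂ (runs u∈ d)))
    ... | no m≢n′  = pending
      (λ p∈ → trans (fire-∉ N₁ x (λ p∈m → disjoint p∈m p∈)) (at-n′ p∈))
      (λ t∈ d′ →
         -- The given order is `m`, then `n′`. Exchanging the two puts `n′` first, so that `runs`
         -- applies, and `m` is appended to the run it yields.
         let _ , d₁ , d₂ = disjoint-commute disjoint (I₁.δ-transformer (proj₁ en , u∈))
                             (I₁.δ-transformer (n′∈ , t∈)) (_ , d , d′)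
             _ , run , _ = runs t∈ d₁
         in _ , Run-congʳ N₂ (fire-comm N₁ x disjoint)
                  (Run₂-old run (enabled-after-n′ disjoint en) u∈
                    -- `(n , r)` cannot recur while `n′` is pending, because `n` and `n′` share
                    -- `agent′`.
                    (λ where refl → disjoint agent′∈n agent′∈) d₂) ,
            -- A final `n′` has all agents as parties, so no other atom can occur while it is
            -- pending and `(n , s t)` never loses its place as the last outcome.
            λ n′≡nf → contradiction (final⇒all-parties n′≡nf)
                        (disjoint (proj₂ (I₁.parties-nonempty (proj₁ en)))))
      where disjoint = λ {p} → pending⇒disjoint at-n′ en m≢n′ {p}

    Sim-run : ∀ {x q σ y q′} → Sim x q → Run N₁ x q σ y q′ → Sim y q′
    Sim-run sim [ e ] = Sim-cong e sim
    Sim-run sim ((en , u∈ , d) ∷ run) = Sim-run (Sim-step sim en u∈ d) run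

    simulate : ∀ {σ y q′} → Run N₁ x₀ q₀ σ y q′ → Sim y q′
    simulate = Sim-run (synced [ (λ _ → refl) ])

    -- If `n′` is pending, it is fired with an arbitrary result; `m` has no party in common with it
    -- and stays enabled.
    catch-up : ∀ {x q m} → Sim x q → Enables N₁ x m → m ≢ n′ →
               ∃ λ σ → ∃₂ λ y q′ → Run N₂ x₀ q₀ σ y q′ × Enables N₁ y m
    catch-up (synced run) en _ = _ , _ , _ , run , en
    catch-up {q = q} (pending at-n′ runs) en m≢n′ =
      let t , t∈ = result′
          _ , d  = IsTransformerOn.left-total (I₁.δ-transformer (n′∈ , t∈)) q
          _ , run , _ = runs t∈ d
      in _ , _ , _ , run , enabled-after-n′ (pending⇒disjoint at-n′ en m≢n′) en

  -- Preservation and reflection of soundness.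

  module FromInitial (q₀ : State Q) = Simulation (initial N₁) q₀
    (λ p v∈ → subst (_∈ N₂.atoms) (sym (x∈⁅y⁆⇒x≡y N₁.n₀ v∈)) n₀∈₂)

  soundness-to : ∀ q₀ → RunSound N₁ isN₁ q₀ → RunSound N₂ isN₂ q₀
  soundness-to q₀ sound = record { enabled = enabled ; completable = completable }
    where
      open FromInitial q₀
      module Sound₁ = RunSound sound

      EnabledAfterRun : Fin k → Set ℓ
      EnabledAfterRun m = ∃ λ σ → ∃₂ λ x q → Run N₂ (initial N₂) q₀ σ x q × Enables N₂ x m

      completable : ∀ {σ x q} → Run N₂ (initial N₂) q₀ σ x q →
                    ∃ λ τ → ∃₂ λ y q′ → Run N₂ x q τ y q′ × IsFinal N₂ y
      completable {x = x} {q} run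
        with Sound₁.completable (proj₂ (expand (Run-congˡ N₂ (sym ∘ initial-same) run)))
      ... | _ , y , q′ , run₁ , fin
        -- The simulation starts at the marking already reached by `N₂`, so that its run extends the
        -- given one. It cannot end pending, since `agent′` would still be ready for `n′` at a final
        -- marking.
        with Simulation.simulate x q (Run-Inside N₂ isN₂ (Inside-initial N₂ isN₂) run) run₁
      ... | Simulation.synced run₂ = _ , y , q′ , run₂ , fin
      ... | Simulation.pending at-n′ _ =
        contradiction (trans (sym (at-n′ agent′∈)) (fin agent′)) ⁅x⁆≢⊥

      committed⇒enabled : ∀ {σ x q p m} → Run N₂ (initial N₁) q₀ σ x q → x p ≡ ⁅ m ⁆ →
                          EnabledAfterRun m
      committed⇒enabled run xp =
        let run′ = Run-congˡ N₂ initial-same run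
            _ , _ , _ , run″ , fin = completable run′
            _ , _ , _ , run‴ , en  = singleton⇒enabled N₂ xp run″ fin
        in _ , _ , _ , Run-++ N₂ run′ run‴ , en

      enabled : ∀ {m} → m ∈ N₂.atoms → EnabledAfterRun m
      enabled {m} m∈ with m ≟ n′
      ... | no m≢n′ =
        let _ , _ , _ , run , en = Sound₁.enabled (atoms₂⊆₁ m∈)
            _ , _ , _ , run₂ , en₂ = catch-up (simulate run) en m≢n′
        in _ , _ , _ , Run-congˡ N₂ initial-same run₂ , Enables₁⇒₂ m∈ en₂
      -- Since `n′` survives, another outcome commits to it. Once `N₂` has fired that outcome, some
      -- party has only `n′` ahead of it, and any completion has to enable `n′`.
      ... | yes refl with kept⇒committed m∈
      ...   | (m″ , u) , (m″∈ , u∈) , ≢nr , (p , p∈ , X≡) with m″ ≟ n′ | Sound₁.enabled m″∈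
      ...     | no m″≢n′ | _ , _ , _ , run , en =
        let _ , x , q , run₂ , en₂ = catch-up (simulate run) en m″≢n′
            _ , d = IsTransformerOn.left-total (I₁.δ-transformer (m″∈ , u∈)) q
        in committed⇒enabled (Run₂-old run₂ en₂ u∈ ≢nr d) (trans (fire-∈ N₁ x p∈) X≡)
      -- The committing outcome may be one of `n′` itself, which `catch-up` does not cover; in the
      -- pending case `runs` yields the marking after that very outcome.
      ...     | yes refl | _ , x , q , run , en
        with simulate run | IsTransformerOn.left-total (I₁.δ-transformer (m″∈ , u∈)) q
      ...       | synced run₂    | _ , d =
        committed⇒enabled (Run₂-old run₂ en u∈ ≢nr d) (trans (fire-∈ N₁ x p∈) X≡)
      ...       | pending _ runs | _ , d =
        committed⇒enabled (proj₁ (proj₂ (runs u∈ d))) (trans (fire-∈ N₁ x p∈) X≡)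

  soundness-from : ∀ q₀ → RunSound N₂ isN₂ q₀ → RunSound N₁ isN₁ q₀
  soundness-from q₀ sound = record { enabled = enabled ; completable = completable }
    where
      open FromInitial q₀
      module Sound₂ = RunSound sound

      expand-initial : ∀ {σ x q} → Run N₂ (initial N₂) q₀ σ x q →
                       ∃ λ σ₁ → Run N₁ (initial N₁) q₀ σ₁ x q
      expand-initial run = expand (Run-congˡ N₂ (sym ∘ initial-same) run)

      enabled : ∀ {m} → m ∈ N₁.atoms →
                ∃ λ σ → ∃₂ λ x q → Run N₁ (initial N₁) q₀ σ x q × Enables N₁ x m
      enabled {m} m∈ with m ≟ n′
      ... | no m≢n′ =
        let _ , _ , _ , run , en = Sound₂.enabled (∈₁⇒∈₂ m≢n′ m∈)
        in _ , _ , _ , proj₂ (expand-initial run) , Enables₂⇒₁ en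
      ... | yes refl =
        let _ , x , q , run , en = Sound₂.enabled n∈₂
            _ , d = IsTransformerOn.left-total (I₁.δ-transformer outcome) q
        in _ , _ , _ ,
           Run-∷ʳ N₁ (proj₂ (expand-initial run)) (Enables₂⇒₁ en , proj₂ outcome , d) ,
           nr-enables-n′ x

      complete₂ : ∀ {σ x q} → Run N₂ (initial N₁) q₀ σ x q →
                  ∃ λ τ → ∃₂ λ y q′ → Run N₁ x q τ y q′ × IsFinal N₁ y
      complete₂ run =
        let _ , _ , _ , run₂ , fin = Sound₂.completable (Run-congˡ N₂ initial-same run)
        in _ , _ , _ , proj₂ (expand run₂) , fin

      completable : ∀ {σ x q} → Run N₁ (initial N₁) q₀ σ x q →
                    ∃ λ τ → ∃₂ λ y q′ → Run N₁ x q τ y q′ × IsFinal N₁ y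
      completable {q = q} run with simulate run
      ... | synced run₂ = complete₂ run₂
      -- `N₂` need not reach `x` itself. Letting `n′` occur in `N₁` with an arbitrary result leads
      -- to a marking that `N₂` does reach, and the completion there is unfolded.
      ... | pending at-n′ runs =
        let t , t∈ = result′
            _ , d  = IsTransformerOn.left-total (I₁.δ-transformer (n′∈ , t∈)) q
            _ , _ , _ , run₁ , fin = complete₂ (proj₁ (proj₂ (runs t∈ d)))
            n′∈x   = λ {p} p∈ → subst (n′ ∈_) (sym (at-n′ {p} p∈)) (x∈⁅x⁆ n′)
        in _ , _ , _ , ((n′∈ , n′∈x) , t∈ , d) ∷ run₁ , fin

  -- Nonemptiness of the state sets supplies a state from which runs can start.
  soundness : (∀ p → Q p) → Sound N₁ ↔ᵖ Sound N₂
  soundness q₀ = mk⇔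
    (from (Sound⇔RunSound N₂ isN₂ q₀) ∘ soundness-to q₀ ∘ to (Sound⇔RunSound N₁ isN₁ q₀))
    (from (Sound⇔RunSound N₁ isN₁ q₀) ∘ soundness-from q₀ ∘ to (Sound⇔RunSound N₂ isN₂ q₀))

  -- Summary transformers.

  summary-to-final : n′ ≡ N₁.nf → ∀ {t q q′} → t ∈ˡ N₁.results n′ →
                     Summary N₁ t q q′ → Summary N₂ (s t) q q′
  summary-to-final n′≡nf {t} {q} t∈ sum with Summary-elim N₁ sum
  ... | σ , y , run , fin with Run-unsnoc N₁ σ run
  ...   | x , q₁ , run₁ , (en , u∈ , d) , e with FromInitial.simulate q run₁
  -- The atom now enabled is the final atom `n′`, which was removed, whereas atoms enabled at a
  -- marking reached in `N₂` belong to `N₂`.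
  ...     | Simulation.synced run₂ =
    contradiction (subst (_∈ N₂.atoms) (sym n′≡nf) (FromInitial.enabled⇒∈₂ q run₂ en))
                  (exclusive⇒∉ (final⇒exclusive n′≡nf))
  ...     | Simulation.pending at-n′ runs
    with runs t∈ (subst (λ m → N₁.δ m t q₁ _) (sym n′≡nf) d)
  -- A summary admits only sequences that end with the final outcome; for a final `n′` the
  -- simulation records that the last outcome is `(n , s t)`.
  ...       | _ , run₂ , last-nr with last-nr n′≡nf
  ...         | _ , refl =
    Summary-intro N₂ (nf-new n′≡nf)
      (Run-congˡ N₂ initial-same (Run-congʳ N₂ e′ run₂)) fin
    where
      e′ : fire N₁ x (n′ , t) ≗ y
      e′ = subst (λ m → fire N₁ x (m , t) ≗ y) (sym n′≡nf) e

  summary-to-nonfinal : n′ ≢ N₁.nf → ∀ {t q q′} → Summary N₁ t q q′ → Summary N₂ t q q′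
  summary-to-nonfinal n′≢nf {t} {q} sum with Summary-elim N₁ sum
  ... | σ , y , run , fin with Run-unsnoc N₁ σ run
  ...   | x , q₁ , run₁ , (en , u∈ , d) , e with FromInitial.simulate q run₁
  ...     | Simulation.synced run₂ =
    Summary-intro N₂ (nf-old n′≢nf)
      (Run-congˡ N₂ initial-same (Run-congʳ N₂ e
        (FromInitial.Run₂-old q run₂ en u∈ (n≢nf ∘ sym ∘ cong proj₁) d))) fin
  -- While `n′` is pending, any other enabled atom is disjoint from it, but the final atom has every
  -- agent as a party.
  ...     | Simulation.pending at-n′ _ =
    contradiction agent′∈ (FromInitial.pending⇒disjoint q at-n′ en (n′≢nf ∘ sym)
      (subst (agent′ ∈_) (sym I₁.parties-nf) ∈⊤))

  summary-from-final : n′ ≡ N₁.nf → ∀ {t q q′} → t ∈ˡ N₁.results n′ →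
                       Summary N₂ (s t) q q′ → Summary N₁ t q q′
  summary-from-final n′≡nf {t} t∈ sum with Summary-elim N₂ sum
  ... | σ , y , run , fin
    with Run-unsnoc N₂ σ (subst (λ m → Run N₂ (initial N₂) _ (σ ∷ʳ (m , s t)) y _)
                                (sym (nf-new n′≡nf)) run)
  ...   | x , q₁ , run₂ , (en , _ , d) , e
    with expand (Run-congˡ N₂ (sym ∘ initial-same) run₂) | Run₁-new en t∈ d
  -- The last outcome unfolds to `(n , r)` followed by `(n′ , t)`, so the sequence obtained for `N₁`
  -- again ends with a final outcome.
  ...     | σ₁ , run₁ | s₁ ∷ s₂ ∷ [ e′ ] =
    Summary-intro N₁ {σ = σ₁ ∷ʳ (n , r)} n′≡nf
      (Run-congʳ N₁ (λ p → trans (e′ p) (e p)) (Run-∷ʳ N₁ (Run-∷ʳ N₁ run₁ s₁) s₂)) fin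

  summary-from-nonfinal : n′ ≢ N₁.nf → ∀ {t q q′} → t ∈ˡ N₁.results N₁.nf →
                          Summary N₂ t q q′ → Summary N₁ t q q′
  summary-from-nonfinal n′≢nf {t} t∈ sum with Summary-elim N₂ sum
  ... | σ , y , run , fin
    with Run-unsnoc N₂ σ (subst (λ m → Run N₂ (initial N₂) _ (σ ∷ʳ (m , t)) y _)
                                (sym (nf-old n′≢nf)) run)
  ...   | x , q₁ , run₂ , (en , _ , d) , e =
    let _ , run₁ = expand (Run-congˡ N₂ (sym ∘ initial-same) run₂)
    in Summary-intro N₁ refl
         (Run-congʳ N₁ e (Run-++ N₁ run₁ (Run₁-old en t∈ (n≢nf ∘ sym ∘ cong proj₁) d))) fin

  -- Equivalence up to the renaming of final results.

  equivalent : (∀ p → Q p) → EquivalentVia finalRenaming N₁ N₂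
  equivalent q₀ with n′ ≟ N₁.nf
  ... | yes n′≡nf = record
    { soundness = soundness q₀
    ; injective = λ t∈ u∈ → s-injective (result-n′ t∈) (result-n′ u∈)
    ; results   = mk⇔ final-results
        (λ u∈ → let t , t∈ , u≡st = ∈-map⁻ s u∈ in
                subst (_∈ˡ finalResults N₂) (sym u≡st)
                  (subst (λ m → s t ∈ˡ N₂.results m) (nf-new n′≡nf)
                    (new-result (result-n′ t∈))))
    ; summaries = λ t∈ → summary-to-final n′≡nf (result-n′ t∈) ,
                         summary-from-final n′≡nf (result-n′ t∈)
    }
    where
      result-n′ : ∀ {t} → t ∈ˡ N₁.results N₁.nf → t ∈ˡ N₁.results n′
      result-n′ {t} = subst (λ m → t ∈ˡ N₁.results m) (sym n′≡nf)

      final-results : ∀ {u} → u ∈ˡ finalResults N₂ → u ∈ˡ map s (finalResults N₁)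
      final-results {u} u∈
        with origin n∈₂ (subst (λ m → u ∈ˡ N₂.results m) (sym (nf-new n′≡nf)) u∈)
      -- The guard for a final `n′` makes `r` the only result of `n`, so every result of `n` in `N₂`
      -- is new.
      ... | old u∈₁ ≢nr = contradiction (cong (n ,_) (final⇒only-result n′≡nf u∈₁)) ≢nr
      ... | new {t} t∈  = ∈-map⁺ s (subst (λ m → t ∈ˡ N₁.results m) n′≡nf t∈)
  ... | no n′≢nf = record
    { soundness = soundness q₀
    ; injective = λ _ _ t≡u → t≡u
    ; results   = λ {u} → subst₂ (λ m ts → u ∈ˡ N₂.results m ↔ᵖ u ∈ˡ ts)
        (nf-old n′≢nf) (sym (map-id _))
        (results-≢ (∈₁⇒∈₂ (n′≢nf ∘ sym) I₁.nf∈atoms) (n≢nf ∘ sym))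
    ; summaries = λ t∈ → summary-to-nonfinal n′≢nf , summary-from-nonfinal n′≢nf t∈
    }

theorem23 : {ℓ : Level} {a k : ℕ} (Q : Fin a → Set ℓ) → (∀ p → Q p) →
    (N₁ N₂ : Net Q k) → IsNegotiation N₁ → (S : Shortcut N₁ N₂) →
    IsNegotiation N₂ × EquivalentVia (Shortcut.finalRenaming S) N₁ N₂
theorem23 Q q₀ N₁ N₂ isN₁ S = isN₂ , equivalent q₀
  where open ShortcutCorrectness N₁ N₂ isN₁ S
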